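{- Let $G_1$ and $G_2$ be two disjoint $(k+1)$-critical hypergraphs with $k\ge2$, let $\tilde e\in E(G_1)$, let $\tilde v$ be a low vertex of $G_2$, and let $s$ be any admissible map for $(\tilde e,G_2,\tilde v)$. Then $G=S(G_1,\tilde e,G_2,\tilde v,s)$ is $(k+1)$-critical, and $\partial_G(V(G_1))$ is a separating edge set of $G$ of size $k$.
   Context: A hypergraph is a pair $G=(V,E)$ of finite sets with $E\subseteq 2^V$ and $|e|\ge2$ for all $e\in E$. A coloring requires every edge to contain two vertices of different colors; $\chi$ is the chromatic number. $G$ is $(k+1)$-critical if $\chi(G)=k+1$ but $\chi(H)\le k$ for every proper subhypergraph $H$. In a $(k+1)$-critical hypergraph, a low vertex is one of degree exactly $k$ (degree = number of edges containing it). $\partial_G(X)$ is the set of edges meeting both $X$ and $V(G)\setminus X$; $\partial_G(v)=\partial_G(\{v\})$. A separating edge set is $F\subseteq E(G)$ such that $G-F$ has more components than $G$. Splitting: let $G_1,G_2$ be disjoint hypergraphs, $\tilde e\in E(G_1)$, $\tilde v\in V(G_2)$, and $s:\partial_{G_2}(\tilde v)\to 2^{\tilde e}$ a map (called admissible) with $s(e)\ne\varnothing$ for all $e$ and $\bigcup_{e}s(e)=\tilde e$. Then $S(G_1,\tilde e,G_2,\tilde v,s)$ is the hypergraph with vertex set $V(G_1)\cup(V(G_2)\setminus\{\tilde v\})$ and edge set $(E(G_1)\setminus\{\tilde e\})\cup(E(G_2)\setminus\partial_{G_2}(\tilde v))\cup\{(e\setminus\{\tilde v\})\cup s(e): e\in\partial_{G_2}(\tilde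 v)\}$. -}

module Defs where

open import Data.Fin.Base using (Fin)
open import Data.Fin.Subset
open import Data.Fin.Subset.Properties
open import Data.List.Base using (List; _++_; [_]; filter; map; length; deduplicate)
open import Data.List.Membership.Propositional using () renaming (_∈_ to _∈ₗ_)
open import Data.List.Membership.Propositional.Properties
  using (∈-filter⁺; ∈-filter⁻; ∈-map⁻; ∈-++⁻; ∈-deduplicate⁻)
import Data.List.Membership.DecPropositional as DecMembership
open import Data.List.Relation.Unary.Unique.Propositional using (Unique)
import Data.List.Relation.Unary.Unique.Propositional.Properties as Uniqueₚ
import Data.List.Relation.Unary.Unique.DecPropositional.Properties as DecUniqueₚ
open import Data.Nat.Base using (ℕ; suc; _≤_; _<_; z≤n; s≤s)
open import Data.Nat.Properties using (≤-trans; ≤-<-trans; ≤-reflexive)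
open import Data.Product using (Σ; ∃; ∃-syntax; _×_; _,_; proj₁; proj₂)
open import Data.Sum using (inj₁; inj₂; [_,_]′)
import Data.Bool.Properties as Bool
import Data.Vec.Properties as Vec
open import Data.Vec.Base using (_∷_; there)
open import Function.Bundles using (_⇔_)
open import Relation.Binary.Construct.Closure.ReflexiveTransitive using (Star)
open import Relation.Binary.Definitions using (DecidableEquality)
open import Relation.Binary.PropositionalEquality using (_≡_; _≢_; refl; subst)
open import Relation.Nullary using (¬_; ¬?; Dec; yes; no; contradiction)
open import Relation.Nullary.Decidable using (_×-dec_)

_≟ˢ_ : ∀ {N} → DecidableEquality (Subset N)
_≟ˢ_ = Vec.≡-dec Bool._≟_

_∈ₗ?_ : ∀ {N} (e : Subset N) (F : List (Subset N)) → Dec (e ∈ₗ F)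
_∈ₗ?_ = DecMembership._∈?_ _≟ˢ_

infix 4 _∈ₗ?_
infixl 6 _∖_

_∖_ : ∀ {N} → List (Subset N) → List (Subset N) → List (Subset N)
E ∖ F = filter (λ e → ¬? (e ∈ₗ? F)) E

-- All vertices are drawn from an ambient finite set Fin N, so that disjointness,
-- subhypergraphs and unions are the literal set-theoretic notions.  A finite set
-- of edges is a duplicate-free list, considered only up to membership; its
-- cardinality is the length of the list.
record Hypergraph (N : ℕ) : Set where
  field
    V        : Subset N
    E        : List (Subset N)
    E-unique : Unique E
    E⊆V      : ∀ {e} → e ∈ₗ E → e ⊆ V
    2≤∣e∣    : ∀ {e} → e ∈ₗ E → 2 ≤ ∣ e ∣

open Hypergraph public

Disjoint : ∀ {N} → Hypergraph N → Hypergraph N → Set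
Disjoint G₁ G₂ = Empty (V G₁ ∩ V G₂)

_⊑_ : ∀ {N} → Hypergraph N → Hypergraph N → Set
H ⊑ G = V H ⊆ V G × (∀ {e} → e ∈ₗ E H → e ∈ₗ E G)

-- H ≢ G is expressed by ¬ (G ⊑ H), because propositional equality of the
-- records would distinguish different orderings of the same edge set.
_⊏_ : ∀ {N} → Hypergraph N → Hypergraph N → Set
H ⊏ G = H ⊑ G × ¬ (G ⊑ H)

-- Colors are bounded only on V G: a map Fin N → Fin c would also color the
-- ambient points outside G, which is impossible for c = 0.
Colorable : ∀ {N} → Hypergraph N → ℕ → Set
Colorable {N} G c =
  Σ (Fin N → ℕ) λ φ →
    (∀ {v} → v ∈ V G → φ v < c) ×
    (∀ {e} → e ∈ₗ E G → ∃[ u ] ∃[ w ] u ∈ e × w ∈ e × φ u ≢ φ w)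

HasChromaticNumber : ∀ {N} → Hypergraph N → ℕ → Set
HasChromaticNumber G c = Colorable G c × (∀ {b} → b < c → ¬ Colorable G b)

-- G is (k+1)-critical.
SucCritical : ∀ {N} → ℕ → Hypergraph N → Set
SucCritical k G =
  HasChromaticNumber G (suc k) ×
  (∀ H → H ⊏ G → ∃[ c ] HasChromaticNumber H c × c ≤ k)

degree : ∀ {N} → Hypergraph N → Fin N → ℕ
degree G v = length (filter (v ∈?_) (E G))

-- Meaningful when G is (k+1)-critical.
LowVertex : ∀ {N} → ℕ → Hypergraph N → Fin N → Set
LowVertex k G v = v ∈ V G × degree G v ≡ k

meetsBoth? : ∀ {N} (X Y e : Subset N) → Dec (Nonempty (e ∩ X) × Nonempty (e ∩ Y))
meetsBoth? X Y e = nonempty? (e ∩ X) ×-dec nonempty? (e ∩ Y)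

∂ : ∀ {N} → Hypergraph N → Subset N → List (Subset N)
∂ G X = filter (meetsBoth? X (V G ─ X)) (E G)

∂ᵥ : ∀ {N} → Hypergraph N → Fin N → List (Subset N)
∂ᵥ G v = ∂ G ⁅ v ⁆

deleteEdges : ∀ {N} → Hypergraph N → List (Subset N) → Hypergraph N
deleteEdges G F = record
  { V        = V G
  ; E        = E G ∖ F
  ; E-unique = Uniqueₚ.filter⁺ (λ e → ¬? (e ∈ₗ? F)) (E-unique G)
  ; E⊆V      = λ e∈ → E⊆V G (proj₁ (∈-filter⁻ (λ e → ¬? (e ∈ₗ? F)) e∈))
  ; 2≤∣e∣    = λ e∈ → 2≤∣e∣ G (proj₁ (∈-filter⁻ (λ e → ¬? (e ∈ₗ? F)) e∈))
  }

Adjacent : ∀ {N} → Hypergraph N → Fin N → Fin N → Set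
Adjacent G u w = ∃[ e ] e ∈ₗ E G × u ∈ e × w ∈ e

Connected : ∀ {N} → Hypergraph N → Fin N → Fin N → Set
Connected G = Star (Adjacent G)

-- X is the vertex set of a component of G (a component is determined by its
-- vertex set).
IsComponent : ∀ {N} → Hypergraph N → Subset N → Set
IsComponent G X = ∃[ v ] v ∈ V G × (∀ u → u ∈ X ⇔ Connected G v u)

HasComponentCount : ∀ {N} → Hypergraph N → ℕ → Set
HasComponentCount {N} G c =
  Σ (List (Subset N)) λ Xs →
    Unique Xs × (∀ X → X ∈ₗ Xs ⇔ IsComponent G X) × length Xs ≡ c

SeparatingEdgeSet : ∀ {N} → Hypergraph N → List (Subset N) → Set
SeparatingEdgeSet G F =
  (∀ {e} → e ∈ₗ F → e ∈ₗ E G) ×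
  ∃[ a ] ∃[ b ] HasComponentCount G a × HasComponentCount (deleteEdges G F) b × a < b

-- The map s : ∂ṽ → 2^ẽ is represented by a total function, of which only the
-- values on ∂ᵥ G₂ ṽ are ever constrained or used.
record Admissible {N} (ẽ : Subset N) (G₂ : Hypergraph N) (ṽ : Fin N)
                  (s : Subset N → Subset N) : Set where
  field
    s⊆ẽ        : ∀ {e} → e ∈ₗ ∂ᵥ G₂ ṽ → s e ⊆ ẽ
    s-nonempty : ∀ {e} → e ∈ₗ ∂ᵥ G₂ ṽ → Nonempty (s e)
    ⋃s≡ẽ       : ⋃ (map s (∂ᵥ G₂ ṽ)) ≡ ẽ

x∈p─q⇒x∉q : ∀ {N} (p q : Subset N) {x} → x ∈ p ─ q → x ∉ q
x∈p─q⇒x∉q (_ ∷ p) (_ ∷ q) (there x∈p─q) (there x∈q) = x∈p─q⇒x∉q p q x∈p─q x∈q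

x∈p-y⇒x≢y : ∀ {N} {p : Subset N} {x y} → x ∈ p - y → x ≢ y
x∈p-y⇒x≢y {p = p} {x} x∈p-x refl = x∈p─q⇒x∉q p ⁅ x ⁆ x∈p-x (x∈⁅x⁆ x)

-‿mono-⊆ : ∀ {N} {p q : Subset N} y → p ⊆ q → p - y ⊆ q - y
-‿mono-⊆ {p = p} y p⊆q x∈p-y =
  x∈p∧x≢y⇒x∈p-y (p⊆q (p─q⊆p p ⁅ y ⁆ x∈p-y)) (x∈p-y⇒x≢y x∈p-y)

two-elements : ∀ {N} {p : Subset N} {x y} → x ∈ p → y ∈ p → y ≢ x → 2 ≤ ∣ p ∣
two-elements x∈p y∈p y≢x =
  ≤-trans (s≤s (≤-<-trans z≤n (x∈p⇒∣p-x∣<∣p∣ (x∈p∧x≢y⇒x∈p-y y∈p y≢x))))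
          (x∈p⇒∣p-x∣<∣p∣ x∈p)

another-element : ∀ {N} {p : Subset N} x → 2 ≤ ∣ p ∣ → Nonempty (p - x)
another-element {p = p} x 2≤∣p∣ with nonempty? (p - x)
... | yes ne = ne
... | no ¬ne = contradiction
  (≤-trans 2≤∣p∣ (≤-trans (p⊆q⇒∣p∣≤∣q∣ p⊆⁅x⁆) (≤-reflexive (∣⁅x⁆∣≡1 x))))
  λ { (s≤s ()) }
  where
  p⊆⁅x⁆ : p ⊆ ⁅ x ⁆
  p⊆⁅x⁆ {y} y∈p with y ∈? ⁅ x ⁆
  ... | yes y∈⁅x⁆ = y∈⁅x⁆
  ... | no y∉⁅x⁆  = contradiction (y , x∈p∧x∉q⇒x∈p─q y∈p y∉⁅x⁆) ¬ne

v∈e⇒e∈∂ᵥ : ∀ {N} (G : Hypergraph N) {v e} → e ∈ₗ E G → v ∈ e → e ∈ₗ ∂ᵥ G v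
v∈e⇒e∈∂ᵥ G {v} {e} e∈E v∈e with another-element v (2≤∣e∣ G e∈E)
... | y , y∈e-v = ∈-filter⁺ (meetsBoth? ⁅ v ⁆ (V G ─ ⁅ v ⁆)) e∈E
  ( (v , x∈p∩q⁺ (v∈e , x∈⁅x⁆ v))
  , (y , x∈p∩q⁺ (p─q⊆p e ⁅ v ⁆ y∈e-v , -‿mono-⊆ v (E⊆V G e∈E) y∈e-v)) )

module Splitting {N} (G₁ : Hypergraph N) (ẽ : Subset N) (G₂ : Hypergraph N) (ṽ : Fin N)
                 (s : Subset N → Subset N) where

  splitV : Subset N
  splitV = V G₁ ∪ (V G₂ - ṽ)

  -- As a set the last part has one edge per e ∈ ∂ᵥ G₂ ṽ; deduplication is there
  -- because lists, unlike sets, do not identify coinciding elements.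
  splitE : List (Subset N)
  splitE = deduplicate _≟ˢ_
    ((E G₁ ∖ [ ẽ ]) ++ (E G₂ ∖ ∂ᵥ G₂ ṽ) ++ map (λ e → (e - ṽ) ∪ s e) (∂ᵥ G₂ ṽ))

  module _ (disjoint : Disjoint G₁ G₂) (ẽ∈E₁ : ẽ ∈ₗ E G₁) (adm : Admissible ẽ G₂ ṽ s) where
    open Admissible adm

    private
      isEdge : ∀ {e} → e ∈ₗ splitE → e ⊆ splitV × 2 ≤ ∣ e ∣
      isEdge {e} e∈ with ∈-++⁻ (E G₁ ∖ [ ẽ ]) (∈-deduplicate⁻ _≟ˢ_ _ e∈)
      ... | inj₁ e∈₁ = (λ x∈e → p⊆p∪q _ (E⊆V G₁ e∈E₁ x∈e)) , 2≤∣e∣ G₁ e∈E₁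
        where e∈E₁ = proj₁ (∈-filter⁻ (λ e → ¬? (e ∈ₗ? [ ẽ ])) e∈₁)
      ... | inj₂ e∈₂₃ with ∈-++⁻ (E G₂ ∖ ∂ᵥ G₂ ṽ) e∈₂₃
      ...   | inj₁ e∈₂ = (λ x∈e → q⊆p∪q (V G₁) _ (x∈V₂-ṽ x∈e)) , 2≤∣e∣ G₂ e∈E₂
        where
        e∈E₂×e∉∂ = ∈-filter⁻ (λ e → ¬? (e ∈ₗ? ∂ᵥ G₂ ṽ)) e∈₂
        e∈E₂     = proj₁ e∈E₂×e∉∂
        x∈V₂-ṽ : e ⊆ V G₂ - ṽ
        x∈V₂-ṽ x∈e = x∈p∧x≢y⇒x∈p-y (E⊆V G₂ e∈E₂ x∈e)
          λ { refl → proj₂ e∈E₂×e∉∂ (v∈e⇒e∈∂ᵥ G₂ e∈E₂ x∈e) }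
      ...   | inj₂ e∈₃ with ∈-map⁻ (λ e → (e - ṽ) ∪ s e) e∈₃
      ...     | f , f∈∂ , refl = ⊆splitV , two-elements (p⊆p∪q _ y∈f-ṽ) (q⊆p∪q _ _ z∈sf) z≢y
        where
        f∈E₂ = proj₁ (∈-filter⁻ (meetsBoth? ⁅ ṽ ⁆ (V G₂ ─ ⁅ ṽ ⁆)) f∈∂)
        f-ṽ⊆V₂-ṽ = -‿mono-⊆ ṽ (E⊆V G₂ f∈E₂)
        sf⊆V₁ : s f ⊆ V G₁
        sf⊆V₁ x∈sf = E⊆V G₁ ẽ∈E₁ (s⊆ẽ f∈∂ x∈sf)
        ⊆splitV : (f - ṽ) ∪ s f ⊆ splitV
        ⊆splitV x∈ = [ (λ x∈f-ṽ → q⊆p∪q (V G₁) _ (f-ṽ⊆V₂-ṽ x∈f-ṽ))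
                     , (λ x∈sf → p⊆p∪q _ (sf⊆V₁ x∈sf)) ]′ (x∈p∪q⁻ (f - ṽ) (s f) x∈)
        y∈f-ṽ = proj₂ (another-element ṽ (2≤∣e∣ G₂ f∈E₂))
        z∈sf  = proj₂ (s-nonempty f∈∂)
        z≢y : proj₁ (s-nonempty f∈∂) ≢ proj₁ (another-element ṽ (2≤∣e∣ G₂ f∈E₂))
        z≢y z≡y = disjoint (_ , x∈p∩q⁺ (sf⊆V₁ (subst (_∈ s f) z≡y z∈sf) , p─q⊆p (V G₂) ⁅ ṽ ⁆ (f-ṽ⊆V₂-ṽ y∈f-ṽ)))

    S : Hypergraph N
    S = record
      { V        = splitV
      ; E        = splitE
      ; E-unique = DecUniqueₚ.deduplicate-! _≟ˢ_ _
      ; E⊆V      = λ e∈ → proj₁ (isEdge e∈)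
      ; 2≤∣e∣    = λ e∈ → proj₂ (isEdge e∈)
      }

{-# OPTIONS --safe #-}
-- A k-coloring of G would make ẽ monochromatic, and its color, given to ṽ, would
-- k-color G₂.  Deleting an edge that comes from G₂, one matches the color of ṽ with
-- the common color of ẽ.  Deleting an edge that comes from G₁, one has a k-coloring
-- of G₁ − ẽ in which ẽ is not monochromatic, whereas every k-coloring of G₂ − ṽ
-- leaves each of the k sets e ∖ {ṽ} monochromatic, with all k colors occurring; since
-- the colors met by the sets s(e) are not all forced to be the same, a permutation of
-- the colors of G₂ − ṽ makes every new edge bichromatic.  The boundary of V(G₁)
-- separates because critical hypergraphs are connected.
module Submission where

open import Defs
open import Data.Nat.Base using (ℕ; zero; suc; _+_; _^_; _≤_; z≤n; s≤s; s≤s⁻¹)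
open import Data.Nat.Properties as ℕ using (≤-refl; ≤-trans; <-≤-trans; ≤-reflexive)
open import Data.Fin.Base using (Fin; zero; suc; toℕ; fromℕ; fromℕ<; inject₁; punchIn; punchOut; finToFun; funToFin)
open import Data.Fin.Properties as Fin using (any?; _≟_)
open import Data.Fin.Permutation as Perm using (Permutation′; _⟨$⟩ʳ_)
open import Data.Fin.Subset using (Subset; _∈_; _∉_; _⊆_; _∪_; _∩_; _─_; _-_; ⁅_⁆; ⋃; Nonempty)
open import Data.Fin.Subset.Properties
open import Data.List.Base using (List; []; _∷_; [_]; _++_; filter; map; length; lookup; deduplicate; allFin)
open import Data.List.Membership.Propositional using (find; lose) renaming (_∈_ to _∈ₗ_)
open import Data.List.Membership.Propositional.Properties
  using (∈-filter⁺; ∈-filter⁻; ∈-map⁺; ∈-map⁻; ∈-++⁺ˡ; ∈-++⁺ʳ; ∈-++⁻; ∈-deduplicate⁺; ∈-deduplicate⁻; ∈-allFin)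
open import Data.List.Membership.Propositional.Properties.WithK using (unique∧set⇒bag)
import Data.List.Properties as List
open import Data.List.Relation.Binary.BagAndSetEquality using (∼bag⇒↭)
open import Data.List.Relation.Binary.Permutation.Propositional.Properties using (↭-length)
import Data.List.Relation.Unary.All as All
import Data.List.Relation.Unary.Any as Any
open import Data.List.Relation.Unary.Any using (here; there)
open import Data.List.Relation.Unary.Any.Properties using (lookup-index)
open import Data.List.Relation.Unary.AllPairs.Core using ([]; _∷_)
open import Data.List.Relation.Unary.Unique.Propositional using (Unique)
import Data.List.Relation.Unary.Unique.Propositional.Properties as Unique
import Data.List.Relation.Unary.Unique.DecPropositional.Properties as DecUnique
open import Data.Bool.Base using (if_then_else_)
open import Data.Product using (∃; ∃₂; ∃-syntax; _×_; _,_; proj₁; proj₂)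
open import Data.Sum.Base using (_⊎_; inj₁; inj₂)
import Data.Vec.Base as Vec
open import Data.Vec.Functional using (updateAt)
open import Data.Vec.Functional.Properties using (updateAt-updates; updateAt-minimal)
open import Data.Vec.Properties using ([]=⇒lookup; lookup⇒[]=; lookup∘tabulate)
open import Function.Base using (_∘_; const; id)
open import Function.Bundles using (_⇔_; mk⇔; Equivalence; Injection)
open import Function.Definitions using (Injective)
open import Function.Properties.Inverse using (↔⇒↣)
open import Relation.Binary.Construct.Closure.ReflexiveTransitive as Star using (Star; ε; _◅_; _◅◅_)
open import Relation.Binary.Definitions using (Decidable; DecidableEquality)
open import Relation.Binary.PropositionalEquality using (_≡_; _≢_; refl; sym; trans; cong; subst)
open import Relation.Nullary using (¬_; ¬?; Dec; yes; no; does; contradiction; _×-dec_; _⊎-dec_)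
open import Relation.Nullary.Decidable using (map′; dec-true; dec-false; decidable-stable)
import Relation.Unary as U

private
  variable
    A B : Set
    N m n : ℕ

-- Finite sets as lists and bit vectors; injections and permutations.

unique-set⇒length≡ : {xs ys : List A} → Unique xs → Unique ys →
                     (∀ {x} → x ∈ₗ xs ⇔ x ∈ₗ ys) → length xs ≡ length ys
unique-set⇒length≡ xs! ys! xs≈ys = ↭-length (∼bag⇒↭ (unique∧set⇒bag xs! ys! xs≈ys))

two≤length : {xs : List A} {x y : A} → x ∈ₗ xs → y ∈ₗ xs → x ≢ y → 2 ≤ length xs
two≤length (here refl) (here refl) x≢y = contradiction refl x≢y
two≤length {xs = _ ∷ _ ∷ _} _ _ _ = s≤s (s≤s z≤n)
two≤length {xs = _ ∷ []} (here refl) (there ()) _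
two≤length {xs = _ ∷ []} (there ()) _ _

∈-⋃⁻ : (ps : List (Subset N)) {x : Fin N} → x ∈ ⋃ ps → ∃[ p ] p ∈ₗ ps × x ∈ p
∈-⋃⁻ []       x∈ = contradiction x∈ ∉⊥
∈-⋃⁻ (p ∷ ps) x∈ with x∈p∪q⁻ p (⋃ ps) x∈
... | inj₁ x∈p = p , here refl , x∈p
... | inj₂ x∈⋃ with q , q∈ , x∈q ← ∈-⋃⁻ ps x∈⋃ = q , there q∈ , x∈q

comprehend : {P : Fin N → Set} → U.Decidable P → Subset N
comprehend P? = Vec.tabulate (does ∘ P?)

∈-comprehend⁺ : {P : Fin N → Set} (P? : U.Decidable P) {x : Fin N} → P x → x ∈ comprehend P?
∈-comprehend⁺ P? {x} px =
  lookup⇒[]= x _ (trans (lookup∘tabulate (does ∘ P?) x) (dec-true (P? x) px))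

∈-comprehend⁻ : {P : Fin N → Set} (P? : U.Decidable P) {x : Fin N} → x ∈ comprehend P? → P x
∈-comprehend⁻ P? {x} x∈ with P? x | trans (sym (lookup∘tabulate (does ∘ P?) x)) ([]=⇒lookup x∈)
... | yes px | _ = px
... | no _ | ()

-- A missed value could be punched out of the codomain, leaving an injection into a set with fewer
-- than `m` elements.
injective⇒surjective : {f : Fin m → Fin n} → n ≤ m → Injective _≡_ _≡_ f → ∀ y → ∃[ x ] f x ≡ y
injective⇒surjective {n = suc n} {f = f} n≤m f-inj y with any? (λ x → f x ≟ y)
... | yes hit = hit
... | no miss = contradiction (≤-trans n≤m (Fin.injective⇒≤ avoid-inj)) ℕ.1+n≰n
  where
  avoids : ∀ x → y ≢ f x
  avoids x y≡fx = miss (x , sym y≡fx)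
  avoid-inj : Injective _≡_ _≡_ (λ x → punchOut (avoids x))
  avoid-inj eq = f-inj (Fin.punchOut-injective (avoids _) (avoids _) eq)

-- As long as a third index is left, give it a color it does not forbid; the two
-- indices with different forbidden colors stay, and finally share two colors.
avoiding-permutation :
  DecidableEquality A → ∀ n (c f : Fin (2 + n) → A) → Injective _≡_ _≡_ c →
  (a b : Fin (2 + n)) → f a ≢ f b → ∃[ π ] (∀ i → c (π ⟨$⟩ʳ i) ≢ f i)
avoiding-permutation {A = A} _≟ᴬ_ zero c f c-inj a b fa≢fb = base
  where
  f₀≢f₁ : f zero ≢ f (suc zero)
  f₀≢f₁ eq = fa≢fb (trans (const-f a) (sym (const-f b)))
    where
    const-f : ∀ i → f i ≡ f zero
    const-f zero       = refl
    const-f (suc zero) = sym eq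
  c₀≢c₁ : c zero ≢ c (suc zero)
  c₀≢c₁ eq with () ← c-inj eq
  base : ∃[ π ] (∀ i → c (π ⟨$⟩ʳ i) ≢ f i)
  -- If the identity fails at some index, the coincidence found there, with `f₀≢f₁` and `c₀≢c₁`,
  -- makes the transposition succeed at both.
  base with c zero ≟ᴬ f zero | c (suc zero) ≟ᴬ f (suc zero)
  ... | yes c₀≡f₀ | _ = Perm.transpose zero (suc zero) , λ
    { zero       c₁≡f₀ → c₀≢c₁ (trans c₀≡f₀ (sym c₁≡f₀))
    ; (suc zero) c₀≡f₁ → f₀≢f₁ (trans (sym c₀≡f₀) c₀≡f₁) }
  ... | no _ | yes c₁≡f₁ = Perm.transpose zero (suc zero) , λ
    { zero       c₁≡f₀ → f₀≢f₁ (trans (sym c₁≡f₀) c₁≡f₁)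
    ; (suc zero) c₀≡f₁ → c₀≢c₁ (trans c₀≡f₁ (sym c₁≡f₁)) }
  ... | no c₀≢f₀ | no c₁≢f₁ = Perm.id , λ { zero → c₀≢f₀ ; (suc zero) → c₁≢f₁ }
avoiding-permutation {A = A} _≟ᴬ_ (suc n) c f c-inj a b fa≢fb = Perm.insert x y π , avoids
  where
  a≢b : a ≢ b
  a≢b = fa≢fb ∘ cong f
  -- `punchOut a≢b` is the place of `b` once `a` is removed, so `x` is a third index, different from
  -- `a` and `b`.
  x′ = punchIn (punchOut a≢b) zero
  x = punchIn a x′
  x≢a : x ≢ a
  x≢a = Fin.punchInᵢ≢i a x′
  x≢b : x ≢ b
  x≢b x≡b = Fin.punchInᵢ≢i (punchOut a≢b) zero
    (Fin.punchIn-injective a _ _ (trans x≡b (sym (Fin.punchIn-punchOut a≢b))))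
  -- By injectivity at most one of `c zero` and `c (suc zero)` equals `f x`.
  allowed : ∃[ y ] c y ≢ f x
  allowed with c zero ≟ᴬ f x
  ... | no c₀≢  = zero , c₀≢
  ... | yes c₀≡ = suc zero , λ c₁≡ → contradiction (c-inj (trans c₀≡ (sym c₁≡))) λ ()
  y = proj₁ allowed
  rest = avoiding-permutation _≟ᴬ_ n (c ∘ punchIn y) (f ∘ punchIn x)
    (Fin.punchIn-injective y _ _ ∘ c-inj) (punchOut x≢a) (punchOut x≢b)
    (λ eq → fa≢fb (trans (cong f (sym (Fin.punchIn-punchOut x≢a)))
                  (trans eq (cong f (Fin.punchIn-punchOut x≢b)))))
  π = proj₁ rest
  avoids : ∀ i → c (Perm.insert x y π ⟨$⟩ʳ i) ≢ f i
  avoids i with x ≟ i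
  ... | yes refl = proj₂ allowed
  ... | no x≢i   = λ eq → proj₂ rest (punchOut x≢i) (trans eq (cong f (sym (Fin.punchIn-punchOut x≢i))))

permutation-injective : (π : Permutation′ n) → Injective _≡_ _≡_ (π ⟨$⟩ʳ_)
permutation-injective π = Injection.injective (↔⇒↣ π)

transpose-source : (i j : Fin n) → Perm.transpose i j ⟨$⟩ʳ i ≡ j
transpose-source i j rewrite dec-true (i ≟ i) refl = refl

-- Colorings

Bichromatic : (Fin N → A) → Subset N → Set
Bichromatic φ e = ∃[ u ] ∃[ w ] u ∈ e × w ∈ e × φ u ≢ φ w

bichromatic? : (φ : Fin N → Fin m) → U.Decidable (Bichromatic φ)
bichromatic? φ e = any? λ u → any? λ w → (u ∈? e) ×-dec (w ∈? e) ×-dec ¬? (φ u ≟ φ w)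

bichromatic-resp : {φ : Fin N → A} {ψ : Fin N → B} {e : Subset N} →
                   (∀ {u w} → u ∈ e → w ∈ e → ψ u ≡ ψ w → φ u ≡ φ w) →
                   Bichromatic φ e → Bichromatic ψ e
bichromatic-resp reflects (u , w , u∈ , w∈ , φu≢φw) = u , w , u∈ , w∈ , φu≢φw ∘ reflects u∈ w∈

bichromatic-cong : {φ ψ : Fin N → A} {e : Subset N} → (∀ {u} → u ∈ e → φ u ≡ ψ u) →
                   Bichromatic φ e → Bichromatic ψ e
bichromatic-cong φ≗ψ =
  bichromatic-resp λ u∈ w∈ ψu≡ψw → trans (φ≗ψ u∈) (trans ψu≡ψw (sym (φ≗ψ w∈)))

bichromatic-escapes : {φ : Fin N → Fin m} {e : Subset N} (c : Fin m) →
                      Bichromatic φ e → ∃[ u ] u ∈ e × φ u ≢ c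
bichromatic-escapes {φ = φ} c (u , w , u∈ , w∈ , φu≢φw) with φ u ≟ c
... | no φu≢c  = u , u∈ , φu≢c
... | yes φu≡c = w , w∈ , λ φw≡c → φu≢φw (trans φu≡c (sym φw≡c))

¬bichromatic⇒constant : {φ : Fin N → Fin m} {e : Subset N} → ¬ Bichromatic φ e →
                        ∀ {u w} → u ∈ e → w ∈ e → φ u ≡ φ w
¬bichromatic⇒constant {φ = φ} ¬b {u} {w} u∈ w∈ =
  decidable-stable (φ u ≟ φ w) λ φu≢φw → ¬b (u , w , u∈ , w∈ , φu≢φw)

colorable⁺ : (G : Hypergraph N) (φ : Fin N → Fin m) →
             (∀ {e} → e ∈ₗ E G → Bichromatic φ e) → Colorable G m
colorable⁺ G φ proper =
  toℕ ∘ φ , (λ {v} _ → Fin.toℕ<n (φ v)) , λ e∈ → bichromatic-resp (λ _ _ → Fin.toℕ-injective) (proper e∈)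

-- With at least one color, truncation also gives the ambient points outside V G a color.
colorable⁻ : (G : Hypergraph N) → Colorable G (suc m) →
             ∃[ φ ] (∀ {e} → e ∈ₗ E G → Bichromatic {A = Fin (suc m)} φ e)
colorable⁻ {N = N} {m = m} G (φ , bounded , proper) = φ′ , λ e∈ →
  bichromatic-resp (λ u∈ w∈ eq → trans (sym (toℕ-φ′ (E⊆V G e∈ u∈)))
                                 (trans (cong toℕ eq) (toℕ-φ′ (E⊆V G e∈ w∈)))) (proper e∈)
  where
  φ′ : Fin N → Fin (suc m)
  φ′ v = fromℕ< (s≤s (ℕ.m⊓n≤n (φ v) m))
  toℕ-φ′ : ∀ {v} → v ∈ V G → toℕ (φ′ v) ≡ φ v
  toℕ-φ′ v∈ = trans (Fin.toℕ-fromℕ< _) (ℕ.m≤n⇒m⊓n≡m (s≤s⁻¹ (bounded v∈)))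

colorable-mono : (G : Hypergraph N) → m ≤ n → Colorable G m → Colorable G n
colorable-mono G m≤n (φ , bounded , proper) = φ , (λ v∈ → <-≤-trans (bounded v∈) m≤n) , proper

edge-nonempty : (G : Hypergraph N) {e : Subset N} → e ∈ₗ E G → Nonempty e
edge-nonempty {N} G {e} e∈ with nonempty? e
... | yes ne = ne
... | no empty with Empty-unique empty
...   | refl = contradiction (2≤∣e∣ G e∈) (subst (λ c → ¬ 2 ≤ c) (sym (∣⊥∣≡0 N)) λ ())

-- Maps into `suc m` colors are coded by the elements of `Fin (suc m ^ N)` and searched. Zero colors
-- are treated apart, since then only the emptiness of `V G` matters.
colorable? : (G : Hypergraph N) (c : ℕ) → Dec (Colorable G c)
colorable? G zero with nonempty? (V G)
... | yes (v , v∈) = no λ { (_ , bounded , _) → contradiction (bounded v∈) λ () }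
... | no empty     = yes (const 0 , (λ v∈ → contradiction (_ , v∈) empty) ,
                          λ e∈ → contradiction (_ , E⊆V G e∈ (proj₂ (edge-nonempty G e∈))) empty)
colorable? {N = N} G (suc m) =
  map′ (λ (i , proper) → colorable⁺ G (finToFun i) (All.lookup proper))
       (λ col → let φ , proper = colorable⁻ G col in
         funToFin φ , All.tabulate λ e∈ →
           bichromatic-cong (λ {u} _ → sym (Fin.finToFun-funToFin φ u)) (proper e∈))
       (any? {n = suc m ^ N} λ i → All.all? (bichromatic? (finToFun {suc m} {N} i)) (E G))

-- The search descends from `n`; once a number of colors fails, `colorable-mono` makes all smaller
-- ones fail.
chromaticNumber : (G : Hypergraph N) (n : ℕ) → Colorable G n → ∃[ c ] HasChromaticNumber G c × c ≤ n
chromaticNumber G zero    col = 0 , (col , λ ()) , z≤n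
chromaticNumber G (suc n) col with colorable? G n
... | yes col′ with c , χ , c≤n ← chromaticNumber G n col′ = c , χ , ℕ.m≤n⇒m≤1+n c≤n
... | no ¬col  = suc n , (col , λ b<1+n → ¬col ∘ colorable-mono G (s≤s⁻¹ b<1+n)) , ≤-refl

-- Being bichromatic is decidable and the edge list finite, so non-colorability yields an actual
-- edge constructively.
monochromatic-edge : (G : Hypergraph N) → ¬ Colorable G m → (φ : Fin N → Fin m) →
                     ∃[ e ] e ∈ₗ E G × ¬ Bichromatic φ e
monochromatic-edge G ¬col φ with Any.any? (λ e → ¬? (bichromatic? φ e)) (E G)
... | yes some = find some
... | no none  = contradiction
  (colorable⁺ G φ λ e∈ → decidable-stable (bichromatic? φ _) (none ∘ lose e∈)) ¬col

glue : Subset N → (Fin N → A) → (Fin N → A) → Fin N → A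
glue X φ ψ v = if does (v ∈? X) then φ v else ψ v

glue-∈ : (X : Subset N) (φ ψ : Fin N → A) {v : Fin N} → v ∈ X → glue X φ ψ v ≡ φ v
glue-∈ X _ _ {v} v∈ rewrite dec-true (v ∈? X) v∈ = refl

glue-∉ : (X : Subset N) (φ ψ : Fin N → A) {v : Fin N} → v ∉ X → glue X φ ψ v ≡ ψ v
glue-∉ X _ _ {v} v∉ rewrite dec-false (v ∈? X) v∉ = refl

-- Critical hypergraphs

module _ (G : Hypergraph N) (crit : SucCritical m G) where

  critical⇒¬colorable : ¬ Colorable G m
  critical⇒¬colorable = proj₂ (proj₁ crit) ≤-refl

  proper-subhypergraph-colorable : (H : Hypergraph N) → H ⊏ G → Colorable H m
  proper-subhypergraph-colorable H H⊏G with c , (col , _) , c≤m ← proj₂ crit H H⊏G =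
    colorable-mono H c≤m col

-- For an edge `e₀`, these are the proper colorings of `G` minus `e₀`, expressed without forming a
-- second hypergraph.
ProperExcept : (G : Hypergraph N) → Subset N → (Fin N → A) → Set
ProperExcept G e₀ φ = ∀ {e} → e ∈ₗ E G → e ≢ e₀ → Bichromatic φ e

module _ (G : Hypergraph N) (crit : SucCritical (suc m) G) where

  edge-critical : ∀ {e₀} → e₀ ∈ₗ E G → ∃[ φ ] ProperExcept {A = Fin (suc m)} G e₀ φ
  edge-critical {e₀} e₀∈ =
    let φ , proper = colorable⁻ G-e₀ (proper-subhypergraph-colorable G crit G-e₀ G-e₀⊏G) in
    φ , λ e∈ e≢e₀ → proper (∈-filter⁺ kept? e∈ λ { (here e≡e₀) → e≢e₀ e≡e₀ })
    where
    G-e₀ = deleteEdges G [ e₀ ]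
    kept? : U.Decidable (λ e → ¬ e ∈ₗ [ e₀ ])
    kept? e = ¬? (e ∈ₗ? [ e₀ ])
    G-e₀⊏G : G-e₀ ⊏ G
    G-e₀⊏G = (id , proj₁ ∘ ∈-filter⁻ kept?) , λ G⊑ → proj₂ (∈-filter⁻ kept? {xs = E G} (proj₂ G⊑ e₀∈)) (here refl)

  -- Deleting an isolated vertex keeps every edge, so a coloring of the smaller hypergraph would
  -- already color `G`.
  no-isolated-vertex : ∀ {v} → v ∈ V G → ∃[ e ] e ∈ₗ E G × v ∈ e
  no-isolated-vertex {v} v∈ with Any.any? (v ∈?_) (E G)
  ... | yes some = find some
  ... | no none  = contradiction (colorable⁺ G (proj₁ col) (proj₂ col)) (critical⇒¬colorable G crit)
    where
    G-v : Hypergraph N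
    G-v = record
      { V = V G - v
      ; E = E G
      ; E-unique = E-unique G
      ; E⊆V = λ e∈ x∈e → x∈p∧x≢y⇒x∈p-y (E⊆V G e∈ x∈e) λ { refl → none (lose e∈ x∈e) }
      ; 2≤∣e∣ = 2≤∣e∣ G
      }
    G-v⊏G : G-v ⊏ G
    G-v⊏G = (p─q⊆p (V G) ⁅ v ⁆ , id) , λ G⊑ → x∈p-y⇒x≢y (proj₁ G⊑ v∈) refl
    col = colorable⁻ G-v (proper-subhypergraph-colorable G crit G-v G-v⊏G)

-- A vertex of the deleted edge may receive the extra color, since edges have at
-- least two elements.
edge-critical⇒colorable : (G : Hypergraph N) {φ : Fin N → Fin m} {e₀ : Subset N} →
  e₀ ∈ₗ E G → ProperExcept G e₀ φ → Colorable G (suc m)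
edge-critical⇒colorable {N = N} {m = m} G {φ} {e₀} e₀∈ proper = colorable⁺ G ψ bichromatic
  where
  u = proj₁ (edge-nonempty G e₀∈)
  u∈e₀ = proj₂ (edge-nonempty G e₀∈)
  ψ : Fin N → Fin (suc m)
  ψ = updateAt (inject₁ ∘ φ) u (const (fromℕ m))
  ψu : ψ u ≡ fromℕ m
  ψu = updateAt-updates u (inject₁ ∘ φ)
  ψ-≢ : ∀ {x} → x ≢ u → ψ x ≡ inject₁ (φ x)
  ψ-≢ x≢u = updateAt-minimal _ u (inject₁ ∘ φ) x≢u
  bichromatic : ∀ {e} → e ∈ₗ E G → Bichromatic ψ e
  bichromatic {e} e∈ with u ∈? e
  ... | yes u∈ with w , w∈ ← another-element u (2≤∣e∣ G e∈) =
    u , w , u∈ , p─q⊆p e ⁅ u ⁆ w∈ , λ ψu≡ψw →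
      Fin.fromℕ≢inject₁ (trans (sym ψu) (trans ψu≡ψw (ψ-≢ (x∈p-y⇒x≢y w∈))))
  ... | no u∉ = bichromatic-resp
    (λ x∈ y∈ eq → Fin.inject₁-injective (trans (sym (ψ-≢ (≢u x∈))) (trans eq (ψ-≢ (≢u y∈)))))
    (proper e∈ λ { refl → u∉ u∈e₀ })
    where
    ≢u : ∀ {x} → x ∈ e → x ≢ u
    ≢u x∈ refl = u∉ x∈

-- A proper subhypergraph misses some edge, because having all edges forces all vertices by the
-- covering hypothesis; the coloring belonging to the missed edge then colors it. The given edge
-- `e₁` is what provides a coloring with one color more.
edge-critical⇒critical : (G : Hypergraph N) → ∃ (_∈ₗ E G) → ¬ Colorable G m →
  (∀ {v} → v ∈ V G → ∃[ e ] e ∈ₗ E G × v ∈ e) →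
  (∀ {e₀} → e₀ ∈ₗ E G → ∃[ φ ] ProperExcept {A = Fin m} G e₀ φ) →
  SucCritical m G
edge-critical⇒critical {m = m} G (e₁ , e₁∈) ¬col covered edge-crit =
  (edge-critical⇒colorable G e₁∈ (proj₂ (edge-crit e₁∈)) ,
   λ b<1+m → ¬col ∘ colorable-mono G (s≤s⁻¹ b<1+m)) ,
  λ H H⊏G → chromaticNumber H m (colorable H H⊏G)
  where
  colorable : ∀ H → H ⊏ G → Colorable H m
  colorable H (H⊑G , G⋢H) with Any.any? (λ e → ¬? (e ∈ₗ? E H)) (E G)
  ... | yes some with e₀ , e₀∈ , e₀∉ ← find some =
    colorable⁺ H (proj₁ (edge-crit e₀∈)) λ e∈ →
      proj₂ (edge-crit e₀∈) (proj₂ H⊑G e∈) λ { refl → e₀∉ e∈ }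
  ... | no none = contradiction G⊑H G⋢H
    where
    E⊆ : ∀ {e} → e ∈ₗ E G → e ∈ₗ E H
    E⊆ e∈ = decidable-stable (_ ∈ₗ? E H) (none ∘ lose e∈)
    V⊆ : V G ⊆ V H
    V⊆ v∈ with e , e∈ , v∈e ← covered v∈ = E⊆V H (E⊆ e∈) v∈e
    G⊑H : G ⊑ H
    G⊑H = V⊆ , E⊆

-- Connectivity

-- `Adjacent` over a bare edge list, which permits induction on the edges.
Linked : List (Subset N) → Fin N → Fin N → Set
Linked F u w = ∃[ e ] e ∈ₗ F × u ∈ e × w ∈ e

-- A walk that uses `e` can be cut at its first entry into `e` and its last exit from it; both outer
-- pieces are walks in `F`.
linked-star? : (F : List (Subset N)) → Decidable (Star (Linked F))
linked-star? [] u w = map′ (λ { refl → ε }) (λ { ε → refl ; ((_ , () , _) ◅ _) }) (u ≟ w)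
linked-star? {N = N} (e ∷ F) u w =
  map′ join split
    (linked-star? F u w ⊎-dec
     (any? λ x → (x ∈? e) ×-dec linked-star? F u x) ×-dec
     (any? λ y → (y ∈? e) ×-dec linked-star? F y w))
  where
  Split : Fin N → Set
  Split v = Star (Linked F) v w ⊎
    (∃[ x ] x ∈ e × Star (Linked F) v x) × (∃[ y ] y ∈ e × Star (Linked F) y w)
  weaken : ∀ {x y} → Star (Linked F) x y → Star (Linked (e ∷ F)) x y
  weaken = Star.map λ (f , f∈ , ends) → f , there f∈ , ends
  join : ∀ {v} → Split v → Star (Linked (e ∷ F)) v w
  join (inj₁ vw) = weaken vw
  join (inj₂ ((_ , x∈ , vx) , (_ , y∈ , yw))) = weaken vx ◅◅ (e , here refl , x∈ , y∈) ◅ weaken yw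
  split : ∀ {v} → Star (Linked (e ∷ F)) v w → Split v
  split ε = inj₁ ε
  split ((_ , here refl , v∈ , y∈) ◅ yw) with split yw
  ... | inj₁ yw′         = inj₂ ((_ , v∈ , ε) , (_ , y∈ , yw′))
  ... | inj₂ (_ , exit)  = inj₂ ((_ , v∈ , ε) , exit)
  split ((f , there f∈ , ends) ◅ yw) with split yw
  ... | inj₁ yw′                       = inj₁ ((f , f∈ , ends) ◅ yw′)
  ... | inj₂ ((x , x∈ , yx) , exit)    = inj₂ ((x , x∈ , (f , f∈ , ends) ◅ yx) , exit)

connected? : (G : Hypergraph N) → Decidable (Connected G)
connected? G = linked-star? (E G)

connected-sym : (G : Hypergraph N) {u w : Fin N} → Connected G u w → Connected G w u
connected-sym G = Star.reverse λ (e , e∈ , u∈ , w∈) → e , e∈ , w∈ , u∈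

component : Hypergraph N → Fin N → Subset N
component G v = comprehend (connected? G v)

∈-component⇔ : (G : Hypergraph N) {v u : Fin N} → u ∈ component G v ⇔ Connected G v u
∈-component⇔ G = mk⇔ (∈-comprehend⁻ (connected? G _)) (∈-comprehend⁺ (connected? G _))

component-isComponent : (G : Hypergraph N) {v : Fin N} → v ∈ V G → IsComponent G (component G v)
component-isComponent G v∈ = _ , v∈ , λ _ → ∈-component⇔ G

isComponent⇒≡component : (G : Hypergraph N) {X : Subset N} → IsComponent G X →
                         ∃[ v ] v ∈ V G × X ≡ component G v
isComponent⇒≡component G (v , v∈ , X⇔) = v , v∈ ,
  ⊆-antisym (from (∈-component⇔ G) ∘ to (X⇔ _)) (from (X⇔ _) ∘ to (∈-component⇔ G))
  where open Equivalence

component-cong : (G : Hypergraph N) {u w : Fin N} → Connected G u w → component G u ≡ component G w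
component-cong G u~w = ⊆-antisym
  (from (∈-component⇔ G) ∘ (connected-sym G u~w ◅◅_) ∘ to (∈-component⇔ G))
  (from (∈-component⇔ G) ∘ (u~w ◅◅_) ∘ to (∈-component⇔ G))
  where open Equivalence

components : Hypergraph N → List (Subset N)
components {N} G = deduplicate _≟ˢ_ (map (component G) (filter (_∈? V G) (allFin N)))

∈-components⇔ : (G : Hypergraph N) (X : Subset N) → X ∈ₗ components G ⇔ IsComponent G X
∈-components⇔ {N} G X = mk⇔ to′ from′
  where
  to′ : X ∈ₗ components G → IsComponent G X
  to′ X∈ with v , v∈ , refl ← ∈-map⁻ (component G) (∈-deduplicate⁻ _≟ˢ_ _ X∈) =
    component-isComponent G (proj₂ (∈-filter⁻ (_∈? V G) {xs = allFin N} v∈))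
  from′ : IsComponent G X → X ∈ₗ components G
  from′ isC with v , v∈ , refl ← isComponent⇒≡component G isC =
    ∈-deduplicate⁺ _≟ˢ_ (∈-map⁺ (component G) (∈-filter⁺ (_∈? V G) (∈-allFin v) v∈))

hasComponentCount : (G : Hypergraph N) → HasComponentCount G (length (components G))
hasComponentCount G = components G , DecUnique.deduplicate-! _≟ˢ_ _ , ∈-components⇔ G , refl

IsConnected : Hypergraph N → Set
IsConnected G = ∀ {u w} → u ∈ V G → w ∈ V G → Connected G u w

connected⇒one-component : (G : Hypergraph N) {v : Fin N} → v ∈ V G → IsConnected G → HasComponentCount G 1
connected⇒one-component G {v} v∈ conn =
  [ component G v ] , All.[] ∷ [] , (λ X → mk⇔ to′ from′) , refl
  where
  to′ : ∀ {X} → X ∈ₗ [ component G v ] → IsComponent G X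
  to′ (here refl) = component-isComponent G v∈
  from′ : ∀ {X} → IsComponent G X → X ∈ₗ [ component G v ]
  from′ isC with u , u∈ , refl ← isComponent⇒≡component G isC = here (component-cong G (conn u∈ v∈))

star-closed : {R : A → A → Set} {P : A → Set} → (∀ {x y} → R x y → P x → P y) →
              ∀ {x y} → Star R x y → P x → P y
star-closed step ε         = id
star-closed step (xy ◅ yz) = star-closed step yz ∘ step xy

-- After the deletion no remaining edge leads out of `X`, so `u` and `w` lie in different
-- components, whereas `G` has only one.
boundary-separating : (G : Hypergraph N) (X : Subset N) {u w : Fin N} → IsConnected G →
  u ∈ V G → u ∈ X → w ∈ V G → w ∉ X → SeparatingEdgeSet G (∂ G X)
boundary-separating G X {u} {w} conn u∈V u∈X w∈V w∉X =
  proj₁ ∘ ∈-filter⁻ meets? ,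
  1 , _ , connected⇒one-component G u∈V conn , hasComponentCount G-∂ ,
  two≤length (from (∈-components⇔ G-∂ _) (component-isComponent G-∂ u∈V))
             (from (∈-components⇔ G-∂ _) (component-isComponent G-∂ w∈V))
             (λ eq → w∉X (star-closed closed
               (to (∈-component⇔ G-∂) (subst (w ∈_) (sym eq) (from (∈-component⇔ G-∂) ε))) u∈X))
  where
  open Equivalence
  meets? = meetsBoth? X (V G ─ X)
  G-∂ = deleteEdges G (∂ G X)
  closed : ∀ {x y} → Adjacent G-∂ x y → x ∈ X → y ∈ X
  closed {x} {y} (e , e∈ , x∈e , y∈e) x∈X = decidable-stable (y ∈? X) λ y∉X → e∉∂
    (∈-filter⁺ meets? e∈G
      ((x , x∈p∩q⁺ (x∈e , x∈X)) , (y , x∈p∩q⁺ (y∈e , x∈p∧x∉q⇒x∈p─q (E⊆V G e∈G y∈e) y∉X))))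
    where
    e∈G = proj₁ (∈-filter⁻ (λ e → ¬? (e ∈ₗ? ∂ G X)) e∈)
    e∉∂ = proj₂ (∈-filter⁻ (λ e → ¬? (e ∈ₗ? ∂ G X)) {xs = E G} e∈)

-- On a component use a coloring whose exceptional edge lies outside it, and elsewhere
-- one whose exceptional edge lies inside.
critical⇒connected : (G : Hypergraph N) → SucCritical (suc m) G → IsConnected G
critical⇒connected {N} {m} G crit {u} {w} u∈ w∈ = decidable-stable (connected? G u w) λ u≁w →
  let e , e∈ , u∈e = no-isolated-vertex G crit u∈
      f , f∈ , w∈f = no-isolated-vertex G crit w∈
      φ , φ-proper = edge-critical G crit f∈
      ψ , ψ-proper = edge-critical G crit e∈
  in critical⇒¬colorable G crit (colorable⁺ G (glue X φ ψ)
       (glue-proper φ ψ u≁w u∈e w∈f φ-proper ψ-proper))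
  where
  open Equivalence
  X = component G u
  glue-proper : ∀ φ ψ → ¬ Connected G u w → ∀ {e f} → u ∈ e → w ∈ f →
    ProperExcept {A = Fin (suc m)} G f φ → ProperExcept G e ψ →
    ∀ {g} → g ∈ₗ E G → Bichromatic (glue X φ ψ) g
  glue-proper φ ψ u≁w u∈e w∈f φ-proper ψ-proper {g} g∈ with nonempty? (g ∩ X)
  -- An edge meeting the component lies inside it, so it is not `f`, which contains the unreachable
  -- `w`; an edge missing the component is not `e`, which contains `u`.
  ... | yes (x , x∈g∩X) =
    bichromatic-cong (λ y∈ → sym (glue-∈ X φ ψ (from (∈-component⇔ G) (reach y∈))))
      (φ-proper g∈ λ { refl → u≁w (reach w∈f) })
    where
    reach : ∀ {y} → y ∈ g → Connected G u y
    reach y∈ = let x∈g , x∈X = x∈p∩q⁻ g X x∈g∩X in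
      to (∈-component⇔ G) x∈X ◅◅ (g , g∈ , x∈g , y∈) ◅ ε
  ... | no misses =
    bichromatic-cong (λ y∈ → sym (glue-∉ X φ ψ λ y∈X → misses (_ , x∈p∩q⁺ (y∈ , y∈X))))
      (ψ-proper g∈ λ { refl → misses (u , x∈p∩q⁺ (u∈e , from (∈-component⇔ G) ε)) })

-- Splitting

∈-∂ᵥ⁻ : (G : Hypergraph N) {v : Fin N} {e : Subset N} → e ∈ₗ ∂ᵥ G v → e ∈ₗ E G × v ∈ e
∈-∂ᵥ⁻ G {v} {e} e∈∂ =
  let e∈ , (x , x∈) , _ = ∈-filter⁻ (meetsBoth? ⁅ v ⁆ (V G ─ ⁅ v ⁆)) {xs = E G} e∈∂
      x∈e , x∈v = x∈p∩q⁻ e ⁅ v ⁆ x∈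
  in e∈ , subst (_∈ e) (x∈⁅y⁆⇒x≡y v x∈v) x∈e

∂ᵥ-unique : (G : Hypergraph N) (v : Fin N) → Unique (∂ᵥ G v)
∂ᵥ-unique G v = Unique.filter⁺ (meetsBoth? ⁅ v ⁆ (V G ─ ⁅ v ⁆)) (E-unique G)

-- Every edge has a second vertex, so each edge at `v` also meets the complement of `v`.
length-∂ᵥ : (G : Hypergraph N) (v : Fin N) → length (∂ᵥ G v) ≡ degree G v
length-∂ᵥ G v = unique-set⇒length≡ (∂ᵥ-unique G v) (Unique.filter⁺ (v ∈?_) (E-unique G))
  (mk⇔ (λ e∈∂ → let e∈ , v∈e = ∈-∂ᵥ⁻ G e∈∂ in ∈-filter⁺ (v ∈?_) e∈ v∈e)
       (λ e∈f → let e∈ , v∈e = ∈-filter⁻ (v ∈?_) {xs = E G} e∈f in v∈e⇒e∈∂ᵥ G e∈ v∈e))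

-- Coloring v itself with c must create a monochromatic edge.
monochromatic-link : (G : Hypergraph N) → ¬ Colorable G m → (v : Fin N) (φ : Fin N → Fin m) →
  (∀ {e} → e ∈ₗ E G → v ∉ e → Bichromatic φ e) →
  ∀ c → ∃[ e ] e ∈ₗ ∂ᵥ G v × (∀ {x} → x ∈ e - v → φ x ≡ c)
monochromatic-link G ¬col v φ proper c with monochromatic-edge G ¬col (updateAt φ v (const c))
... | e , e∈ , ¬b with v ∈? e
...   | no v∉  = contradiction (bichromatic-cong (λ {u} u∈ →
          sym (updateAt-minimal u v φ λ { refl → v∉ u∈ })) (proper e∈ v∉)) ¬b
...   | yes v∈ = e , v∈e⇒e∈∂ᵥ G e∈ v∈ , λ {x} x∈ →
          trans (sym (updateAt-minimal x v φ (x∈p-y⇒x≢y x∈)))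
          (trans (¬bichromatic⇒constant ¬b (p─q⊆p e ⁅ v ⁆ x∈) v∈) (updateAt-updates v φ))

-- Links of different colors are different edges, so the choice is onto by counting.
links-exhaust : (G : Hypergraph N) (v : Fin N) (φ : Fin N → Fin m) → length (∂ᵥ G v) ≡ m →
  (link : ∀ c → ∃[ e ] e ∈ₗ ∂ᵥ G v × (∀ {x} → x ∈ e - v → φ x ≡ c)) →
  ∀ {f} → f ∈ₗ ∂ᵥ G v → ∃[ c ] proj₁ (link c) ≡ f
links-exhaust {m = m} G v φ len link {f} f∈ =
  let c , hit = injective⇒surjective (≤-reflexive len) position-inj (Any.index f∈) in
  c , trans (lookup-index (proj₁ (proj₂ (link c))))
      (trans (cong (lookup (∂ᵥ G v)) hit) (sym (lookup-index f∈)))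
  where
  position : Fin m → Fin (length (∂ᵥ G v))
  position c = Any.index (proj₁ (proj₂ (link c)))
  position-inj : Injective _≡_ _≡_ position
  position-inj {c} {d} eq =
    let e , e∈ , e≡c = link c
        e′ , e′∈ , e′≡d = link d
        e≡e′ = trans (lookup-index e∈) (trans (cong (lookup (∂ᵥ G v)) eq) (sym (lookup-index e′∈)))
        x , x∈ = another-element v (2≤∣e∣ G (proj₁ (∈-∂ᵥ⁻ G e∈)))
    in trans (sym (e≡c x∈)) (e′≡d (subst (λ g → x ∈ g - v) e≡e′ x∈))

-- If `u` and `w` lie in different sets, both are chosen. If they lie in the same set, the
-- representative of any other set differs in color from one of them; this takes at least two sets.
nonconstant-choice : (φ : Fin N → Fin m) (t : Fin (2 + n) → Subset N) → (∀ i → Nonempty (t i)) →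
  ∀ {i j u w} → u ∈ t i → w ∈ t j → φ u ≢ φ w →
  ∃[ p ] (∀ i → p i ∈ t i) × ∃₂ λ a b → φ (p a) ≢ φ (p b)
nonconstant-choice {N = N} {n = n} φ t ne {i} {j} {u} {w} u∈ w∈ φu≢φw = result
  where
  p₀ : Fin (2 + n) → Fin N
  p₀ = proj₁ ∘ ne
  replace : (p : Fin (2 + n) → Fin N) → (∀ l → p l ∈ t l) → ∀ h {x} → x ∈ t h →
            ∀ l → updateAt p h (const x) l ∈ t l
  replace p p∈ h {x} x∈ l with l ≟ h
  ... | yes refl = subst (_∈ t l) (sym (updateAt-updates l p)) x∈
  ... | no l≢h   = subst (_∈ t l) (sym (updateAt-minimal l h p l≢h)) (p∈ l)
  p₀∈ = proj₂ ∘ ne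
  other = punchIn i zero
  other≢i : other ≢ i
  other≢i = Fin.punchInᵢ≢i i zero
  separate : ∀ {x} → x ∈ t i → φ (p₀ other) ≢ φ x →
             ∃[ p ] (∀ i → p i ∈ t i) × ∃₂ λ a b → φ (p a) ≢ φ (p b)
  separate {x} x∈ φo≢φx = updateAt p₀ i (const x) , replace p₀ p₀∈ i x∈ , other , i , λ eq → φo≢φx
    (trans (cong φ (sym (updateAt-minimal other i p₀ other≢i)))
    (trans eq (cong φ (updateAt-updates i p₀))))
  result : ∃[ p ] (∀ i → p i ∈ t i) × ∃₂ λ a b → φ (p a) ≢ φ (p b)
  result with i ≟ j
  ... | no i≢j = updateAt p₁ j (const w) , replace p₁ (replace p₀ p₀∈ i u∈) j w∈ , i , j , λ eq → φu≢φw
    (trans (cong φ (sym (trans (updateAt-minimal i j p₁ i≢j) (updateAt-updates i p₀))))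
    (trans eq (cong φ (updateAt-updates j p₁))))
    where p₁ = updateAt p₀ i (const u)
  ... | yes refl with φ (p₀ other) ≟ φ u
  ...   | no φo≢φu  = separate u∈ φo≢φu
  ...   | yes φo≡φu = separate w∈ λ φo≡φw → φu≢φw (trans (sym φo≡φu) φo≡φw)

-- The color of the representative chosen in `t c` is the one forbidden as the new value of `c`.
avoiding-recoloring : (φ : Fin N → Fin (2 + n)) (t : Fin (2 + n) → Subset N) → (∀ i → Nonempty (t i)) →
  ∀ {i j u w} → u ∈ t i → w ∈ t j → φ u ≢ φ w →
  ∃[ τ ] Injective _≡_ _≡_ τ × (∀ c → ∃[ z ] z ∈ t c × τ c ≢ φ z)
avoiding-recoloring {n = n} φ t ne u∈ w∈ φu≢φw =
  let p , p∈ , a , b , pa≢pb = nonconstant-choice φ t ne u∈ w∈ φu≢φw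
      π , avoids = avoiding-permutation _≟_ n id (φ ∘ p) id a b pa≢pb
  in π ⟨$⟩ʳ_ , permutation-injective π , λ c → p c , p∈ c , avoids c

module _ (G₁ G₂ : Hypergraph N) (disjoint : Disjoint G₁ G₂)
         {ẽ : Subset N} (ẽ∈E₁ : ẽ ∈ₗ E G₁) (ṽ : Fin N)
         (s : Subset N → Subset N) (adm : Admissible ẽ G₂ ṽ s) where

  open Admissible adm

  private
    G : Hypergraph N
    G = Splitting.S G₁ ẽ G₂ ṽ s disjoint ẽ∈E₁ adm

  reattach : Subset N → Subset N
  reattach f = (f - ṽ) ∪ s f

  -- A view of the edges of `G` by origin, so that later arguments match on cases instead of
  -- unpacking deduplication and concatenation.
  data SplitEdge : Subset N → Set where
    left  : ∀ {e} → e ∈ₗ E G₁ → e ≢ ẽ → SplitEdge e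
    right : ∀ {f} → f ∈ₗ E G₂ → ṽ ∉ f → SplitEdge f
    cross : ∀ {f} → f ∈ₗ ∂ᵥ G₂ ṽ → SplitEdge (reattach f)

  private
    E₁′ = E G₁ ∖ [ ẽ ]
    E₂′ = E G₂ ∖ ∂ᵥ G₂ ṽ

  splitEdge⁻ : ∀ {e} → e ∈ₗ E G → SplitEdge e
  splitEdge⁻ e∈ with ∈-++⁻ E₁′ (∈-deduplicate⁻ _≟ˢ_ _ e∈)
  ... | inj₁ e∈₁ with e∈E₁ , e∉ ← ∈-filter⁻ (λ e → ¬? (e ∈ₗ? [ ẽ ])) {xs = E G₁} e∈₁ =
    left e∈E₁ (e∉ ∘ here)
  ... | inj₂ e∈₂₃ with ∈-++⁻ E₂′ e∈₂₃
  ...   | inj₁ e∈₂ with e∈E₂ , e∉∂ ← ∈-filter⁻ (λ e → ¬? (e ∈ₗ? ∂ᵥ G₂ ṽ)) {xs = E G₂} e∈₂ =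
    right e∈E₂ (e∉∂ ∘ v∈e⇒e∈∂ᵥ G₂ e∈E₂)
  ...   | inj₂ e∈₃ with f , f∈∂ , refl ← ∈-map⁻ reattach e∈₃ = cross f∈∂

  splitEdge⁺ : ∀ {e} → SplitEdge e → e ∈ₗ E G
  splitEdge⁺ (left e∈ e≢ẽ) = ∈-deduplicate⁺ _≟ˢ_
    (∈-++⁺ˡ (∈-filter⁺ (λ e → ¬? (e ∈ₗ? [ ẽ ])) e∈ λ { (here e≡ẽ) → e≢ẽ e≡ẽ }))
  splitEdge⁺ (right f∈ ṽ∉f) = ∈-deduplicate⁺ _≟ˢ_ (∈-++⁺ʳ E₁′
    (∈-++⁺ˡ (∈-filter⁺ (λ e → ¬? (e ∈ₗ? ∂ᵥ G₂ ṽ)) f∈ (ṽ∉f ∘ proj₂ ∘ ∈-∂ᵥ⁻ G₂))))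
  splitEdge⁺ (cross f∈∂) = ∈-deduplicate⁺ _≟ˢ_ (∈-++⁺ʳ E₁′ (∈-++⁺ʳ E₂′ (∈-map⁺ reattach f∈∂)))

  V₂∌V₁ : ∀ {x} → x ∈ V G₂ → x ∉ V G₁
  V₂∌V₁ x∈₂ x∈₁ = disjoint (_ , x∈p∩q⁺ (x∈₁ , x∈₂))

  s⊆V₁ : ∀ {f} → f ∈ₗ ∂ᵥ G₂ ṽ → s f ⊆ V G₁
  s⊆V₁ f∈∂ = E⊆V G₁ ẽ∈E₁ ∘ s⊆ẽ f∈∂

  link⊆V₂ : ∀ {f} → f ∈ₗ ∂ᵥ G₂ ṽ → f - ṽ ⊆ V G₂
  link⊆V₂ {f} f∈∂ = E⊆V G₂ (proj₁ (∈-∂ᵥ⁻ G₂ f∈∂)) ∘ p─q⊆p f ⁅ ṽ ⁆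

  ẽ-covered : ∀ {x} → x ∈ ẽ → ∃[ f ] f ∈ₗ ∂ᵥ G₂ ṽ × x ∈ s f
  ẽ-covered {x} x∈ with _ , p∈ , x∈p ← ∈-⋃⁻ (map s (∂ᵥ G₂ ṽ)) (subst (x ∈_) (sym ⋃s≡ẽ) x∈)
    with f , f∈∂ , refl ← ∈-map⁻ s p∈ = f , f∈∂ , x∈p

  -- A vertex of the lost edge `ẽ` lies in some `s f`, since these sets cover `ẽ`; a vertex other
  -- than `ṽ` of an edge at `ṽ` stays in the reattached edge.
  splitting-covered : (∀ {v} → v ∈ V G₁ → ∃[ e ] e ∈ₗ E G₁ × v ∈ e) →
                      (∀ {v} → v ∈ V G₂ → ∃[ e ] e ∈ₗ E G₂ × v ∈ e) →
                      ∀ {v} → v ∈ V G → ∃[ e ] e ∈ₗ E G × v ∈ e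
  splitting-covered covered₁ covered₂ {v} v∈ with x∈p∪q⁻ (V G₁) (V G₂ - ṽ) v∈
  ... | inj₁ v∈₁ with e , e∈ , v∈e ← covered₁ v∈₁ with e ≟ˢ ẽ
  ...   | no e≢ẽ   = e , splitEdge⁺ (left e∈ e≢ẽ) , v∈e
  ...   | yes refl with f , f∈∂ , v∈sf ← ẽ-covered v∈e =
    reattach f , splitEdge⁺ (cross f∈∂) , q⊆p∪q (f - ṽ) (s f) v∈sf
  splitting-covered covered₁ covered₂ {v} v∈ | inj₂ v∈₂
    with f , f∈ , v∈f ← covered₂ (p─q⊆p (V G₂) ⁅ ṽ ⁆ v∈₂) with ṽ ∈? f
  ... | no ṽ∉f  = f , splitEdge⁺ (right f∈ ṽ∉f) , v∈f
  ... | yes ṽ∈f = reattach f , splitEdge⁺ (cross (v∈e⇒e∈∂ᵥ G₂ f∈ ṽ∈f)) ,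
    p⊆p∪q (s f) (x∈p∧x≢y⇒x∈p-y v∈f (x∈p-y⇒x≢y v∈₂))

  -- Some link at `ṽ` is monochromatic in the color of `ẽ`; together with `s f`, a subset of `ẽ`, it
  -- forms a monochromatic edge of `G`.
  splitting-¬colorable : ¬ Colorable G₁ (suc m) → ¬ Colorable G₂ (suc m) → ¬ Colorable G (suc m)
  splitting-¬colorable {m = m} ¬col₁ ¬col₂ col with colorable⁻ G col
  ... | φ , proper with monochromatic-edge G₁ ¬col₁ φ
  ...   | e , e∈ , ¬b with e ≟ˢ ẽ
  ...     | no e≢ẽ = ¬b (proper (splitEdge⁺ (left e∈ e≢ẽ)))
  ...     | yes refl = constant⇒¬bichromatic (proper (splitEdge⁺ (cross f∈∂)))
    where
    z = proj₁ (edge-nonempty G₁ ẽ∈E₁)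
    link = monochromatic-link G₂ ¬col₂ ṽ φ (λ f∈ ṽ∉f → proper (splitEdge⁺ (right f∈ ṽ∉f))) (φ z)
    f = proj₁ link
    f∈∂ = proj₁ (proj₂ link)
    constant : ∀ {x} → x ∈ reattach f → φ x ≡ φ z
    constant x∈ with x∈p∪q⁻ (f - ṽ) (s f) x∈
    ... | inj₁ x∈f  = proj₂ (proj₂ link) x∈f
    ... | inj₂ x∈sf = ¬bichromatic⇒constant ¬b (s⊆ẽ f∈∂ x∈sf) (proj₂ (edge-nonempty G₁ ẽ∈E₁))
    constant⇒¬bichromatic : ¬ Bichromatic φ (reattach f)
    constant⇒¬bichromatic (u , w , u∈ , w∈ , φu≢φw) = φu≢φw (trans (constant u∈) (sym (constant w∈)))

  glue-reattach : {φ₁ φ₂ : Fin N → A} {f : Subset N} → f ∈ₗ ∂ᵥ G₂ ṽ →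
    ∀ {x z} → x ∈ f - ṽ → z ∈ s f → φ₂ x ≢ φ₁ z → Bichromatic (glue (V G₁) φ₁ φ₂) (reattach f)
  glue-reattach {φ₁ = φ₁} {φ₂} {f} f∈∂ {x} {z} x∈ z∈ φx≢φz =
    x , z , p⊆p∪q (s f) x∈ , q⊆p∪q (f - ṽ) (s f) z∈ , λ eq → φx≢φz
      (trans (sym (glue-∉ (V G₁) φ₁ φ₂ (V₂∌V₁ (link⊆V₂ f∈∂ x∈))))
      (trans eq (glue-∈ (V G₁) φ₁ φ₂ (s⊆V₁ f∈∂ z∈))))

  glue-left : {φ₁ φ₂ : Fin N → A} {e : Subset N} → e ∈ₗ E G₁ →
              Bichromatic φ₁ e → Bichromatic (glue (V G₁) φ₁ φ₂) e
  glue-left {φ₁ = φ₁} {φ₂} e∈ = bichromatic-cong λ x∈ → sym (glue-∈ (V G₁) φ₁ φ₂ (E⊆V G₁ e∈ x∈))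

  glue-right : {φ₁ φ₂ : Fin N → A} {f : Subset N} → f ∈ₗ E G₂ →
               Bichromatic φ₂ f → Bichromatic (glue (V G₁) φ₁ φ₂) f
  glue-right {φ₁ = φ₁} {φ₂} f∈ = bichromatic-cong λ x∈ → sym (glue-∉ (V G₁) φ₁ φ₂ (V₂∌V₁ (E⊆V G₂ f∈ x∈)))

  -- The coloring φ₁ is constant on ẽ; swapping colors makes the constant that of ṽ,
  -- so the vertices of s f take over the role of ṽ in f.
  splitting-edge-critical₂ : ¬ Colorable G₁ m →
    {φ₁ φ₂ : Fin N → Fin m} {f₀ e₀ : Subset N} → ProperExcept G₁ ẽ φ₁ → ProperExcept G₂ f₀ φ₂ →
    (∀ {f} → ṽ ∉ f → f ≢ e₀ → f ≢ f₀) → (∀ {f} → ṽ ∈ f → reattach f ≢ e₀ → f ≢ f₀) →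
    ∃[ φ ] ProperExcept {A = Fin m} G e₀ φ
  splitting-edge-critical₂ {m = m} ¬col₁ {φ₁} {φ₂} {f₀} {e₀} proper₁ proper₂ right≢ cross≢ =
    φ , bichromatic ∘ splitEdge⁻
    where
    z = proj₁ (edge-nonempty G₁ ẽ∈E₁)
    z∈ = proj₂ (edge-nonempty G₁ ẽ∈E₁)
    π = Perm.transpose (φ₁ z) (φ₂ ṽ)
    τ : Fin m → Fin m
    τ = π ⟨$⟩ʳ_
    φ : Fin N → Fin m
    φ = glue (V G₁) (τ ∘ φ₁) φ₂
    -- Some edge of `G₁` is monochromatic under `φ₁`, and `ẽ` is the only candidate.
    ẽ-constant : ∀ {x} → x ∈ ẽ → φ₁ x ≡ φ₁ z
    ẽ-constant x∈ with e , e∈ , ¬b ← monochromatic-edge G₁ ¬col₁ φ₁ with e ≟ˢ ẽ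
    ... | no e≢ẽ   = contradiction (proper₁ e∈ e≢ẽ) ¬b
    ... | yes refl = ¬bichromatic⇒constant ¬b x∈ z∈
    bichromatic : ∀ {e} → SplitEdge e → e ≢ e₀ → Bichromatic φ e
    bichromatic (left e∈ e≢ẽ) _ =
      glue-left e∈ (bichromatic-resp (λ _ _ → permutation-injective π) (proper₁ e∈ e≢ẽ))
    bichromatic (right f∈ ṽ∉f) f≢e₀ = glue-right f∈ (proper₂ f∈ (right≢ ṽ∉f f≢e₀))
    bichromatic (cross f∈∂) ≢e₀
      with f∈ , ṽ∈f ← ∈-∂ᵥ⁻ G₂ f∈∂
      -- The edge `f` has a vertex `x` not colored like `ṽ`, while the vertices of `s f` now carry
      -- the color of `ṽ`.
      with x , x∈ , φx≢φṽ ← bichromatic-escapes (φ₂ ṽ) (proper₂ f∈ (cross≢ ṽ∈f ≢e₀))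
         | y , y∈ ← s-nonempty f∈∂ =
      glue-reattach f∈∂ (x∈p∧x≢y⇒x∈p-y x∈ λ { refl → φx≢φṽ refl }) y∈
        λ eq → φx≢φṽ (trans eq (trans (cong τ (ẽ-constant (s⊆ẽ f∈∂ y∈))) (transpose-source (φ₁ z) (φ₂ ṽ))))

  -- Without ṽ, each edge at ṽ leaves a monochromatic link, one for each color, while φ₁
  -- is not constant on ẽ; so the colors of φ₂ can be permuted such that each link gets a
  -- color different from that of some vertex of s f.
  splitting-edge-critical₁ : ¬ Colorable G₂ (2 + m) → length (∂ᵥ G₂ ṽ) ≡ 2 + m →
    {φ₁ φ₂ : Fin N → Fin (2 + m)} {e₀ : Subset N} → e₀ ≢ ẽ → ProperExcept G₁ e₀ φ₁ →
    (∀ {f} → f ∈ₗ E G₂ → ṽ ∉ f → Bichromatic φ₂ f) →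
    ∃[ φ ] ProperExcept {A = Fin (2 + m)} G e₀ φ
  splitting-edge-critical₁ {m = m} ¬col₂ deg {φ₁} {φ₂} {e₀} e₀≢ẽ proper₁ proper₂ =
    recolor (monochromatic-link G₂ ¬col₂ ṽ φ₂ proper₂)
    where
    recolor : (∀ c → ∃[ e ] e ∈ₗ ∂ᵥ G₂ ṽ × (∀ {x} → x ∈ e - ṽ → φ₂ x ≡ c)) →
              ∃[ φ ] ProperExcept {A = Fin (2 + m)} G e₀ φ
    recolor link
      -- The edge `ẽ` differs from the exceptional edge `e₀`, so `φ₁` shows two colors on it.
      with u , w , u∈ẽ , w∈ẽ , φu≢φw ← proper₁ ẽ∈E₁ (e₀≢ẽ ∘ sym)
      with f , f∈∂ , u∈sf ← ẽ-covered u∈ẽ | g , g∈∂ , w∈sg ← ẽ-covered w∈ẽ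
      -- Edges at `ṽ` are indexed by the colors of their links, so the sets `s f` become a family
      -- indexed by colors.
      with i , refl ← links-exhaust G₂ ṽ φ₂ deg link f∈∂
         | j , refl ← links-exhaust G₂ ṽ φ₂ deg link g∈∂
      with τ , τ-inj , avoids ← avoiding-recoloring φ₁ (s ∘ proj₁ ∘ link)
             (s-nonempty ∘ proj₁ ∘ proj₂ ∘ link) {i} {j} u∈sf w∈sg φu≢φw =
      φ , bichromatic ∘ splitEdge⁻
      where
      φ : Fin N → Fin (2 + m)
      φ = glue (V G₁) φ₁ (τ ∘ φ₂)
      bichromatic : ∀ {e} → SplitEdge e → e ≢ e₀ → Bichromatic φ e
      bichromatic (left e∈ _) e≢e₀ = glue-left e∈ (proper₁ e∈ e≢e₀)
      bichromatic (right f∈ ṽ∉f) _ =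
        glue-right f∈ (bichromatic-resp (λ _ _ → τ-inj) (proper₂ f∈ ṽ∉f))
      bichromatic (cross {f} f∈∂) _
        with c , link≡f ← links-exhaust G₂ ṽ φ₂ deg link f∈∂
        with x , x∈ ← another-element ṽ (2≤∣e∣ G₂ (proj₁ (∈-∂ᵥ⁻ G₂ f∈∂)))
           | z , z∈ , τc≢φz ← avoids c =
        -- The link vertex `x` has color `c` under `φ₂`, hence `τ c` after recoloring, and `z` in
        -- `s f` was chosen to differ from that.
        glue-reattach f∈∂ x∈ (subst (λ e → z ∈ s e) link≡f z∈) λ eq → τc≢φz
          (trans (cong τ (sym (proj₂ (proj₂ (link c)) (subst (λ e → x ∈ e - ṽ) (sym link≡f) x∈)))) eq)

  splitting-critical : SucCritical (2 + m) G₁ → SucCritical (2 + m) G₂ →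
    ṽ ∈ V G₂ → length (∂ᵥ G₂ ṽ) ≡ 2 + m → SucCritical (2 + m) G
  splitting-critical {m = m} crit₁ crit₂ ṽ∈ deg
    with f₁ , f₁∈ , ṽ∈f₁ ← no-isolated-vertex G₂ crit₂ ṽ∈ =
    edge-critical⇒critical G (_ , splitEdge⁺ (cross (v∈e⇒e∈∂ᵥ G₂ f₁∈ ṽ∈f₁)))
      (splitting-¬colorable ¬col₁ ¬col₂)
      (splitting-covered (no-isolated-vertex G₁ crit₁) (no-isolated-vertex G₂ crit₂))
      (edge-crit ∘ splitEdge⁻)
    where
    ¬col₁ = critical⇒¬colorable G₁ crit₁
    ¬col₂ = critical⇒¬colorable G₂ crit₂
    φ₁-proper = proj₂ (edge-critical G₁ crit₁ ẽ∈E₁)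
    edge-crit : ∀ {e₀} → SplitEdge e₀ → ∃[ φ ] ProperExcept {A = Fin (2 + m)} G e₀ φ
    edge-crit (left e₀∈ e₀≢ẽ) = splitting-edge-critical₁ ¬col₂ deg e₀≢ẽ
      (proj₂ (edge-critical G₁ crit₁ e₀∈))
      -- A coloring whose exceptional edge `f₁` contains `ṽ` is proper on every edge avoiding `ṽ`.
      (λ f∈ ṽ∉f → proj₂ (edge-critical G₂ crit₂ f₁∈) f∈ λ { refl → ṽ∉f ṽ∈f₁ })
    -- The exceptional edge of `G` is `f₀` itself here and `reattach f₀` in the next case; the last
    -- two arguments carry the exception back to `f₀` in `G₂`.
    edge-crit (right f₀∈ ṽ∉f₀) = splitting-edge-critical₂ ¬col₁ φ₁-proper
      (proj₂ (edge-critical G₂ crit₂ f₀∈)) (λ _ → id) (λ { ṽ∈f _ refl → ṽ∉f₀ ṽ∈f })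
    edge-crit (cross f₀∈∂) with f₀∈ , ṽ∈f₀ ← ∈-∂ᵥ⁻ G₂ f₀∈∂ = splitting-edge-critical₂ ¬col₁ φ₁-proper
      (proj₂ (edge-critical G₂ crit₂ f₀∈)) (λ { ṽ∉f _ refl → ṽ∉f ṽ∈f₀ }) (λ { _ ≢e₀ refl → ≢e₀ refl })

  -- The boundary of `V G₁` in the splitting.

  ∈-boundary⇔ : ∀ {e} → e ∈ₗ ∂ G (V G₁) ⇔ e ∈ₗ map reattach (∂ᵥ G₂ ṽ)
  ∈-boundary⇔ {e} = mk⇔ to′ from′
    where
    meets? = meetsBoth? (V G₁) (V G ─ V G₁)
    crossing : ∀ {e} → SplitEdge e → Nonempty (e ∩ V G₁) → Nonempty (e ∩ (V G ─ V G₁)) →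
               e ∈ₗ map reattach (∂ᵥ G₂ ṽ)
    crossing {e} (left e∈ _) _ (y , y∈) with y∈e , y∈─ ← x∈p∩q⁻ e (V G ─ V G₁) y∈ =
      contradiction (E⊆V G₁ e∈ y∈e) (x∈p─q⇒x∉q (V G) (V G₁) y∈─)
    crossing {e} (right e∈ _) (x , x∈) _ with x∈e , x∈V₁ ← x∈p∩q⁻ e (V G₁) x∈ =
      contradiction x∈V₁ (V₂∌V₁ (E⊆V G₂ e∈ x∈e))
    crossing (cross f∈∂) _ _ = ∈-map⁺ reattach f∈∂
    to′ : e ∈ₗ ∂ G (V G₁) → e ∈ₗ map reattach (∂ᵥ G₂ ṽ)
    to′ e∈∂ with e∈ , meets₁ , meets₂ ← ∈-filter⁻ meets? {xs = E G} e∈∂ =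
      crossing (splitEdge⁻ e∈) meets₁ meets₂
    from′ : e ∈ₗ map reattach (∂ᵥ G₂ ṽ) → e ∈ₗ ∂ G (V G₁)
    from′ e∈ with f , f∈∂ , refl ← ∈-map⁻ reattach e∈
      with z , z∈ ← s-nonempty f∈∂ | x , x∈ ← another-element ṽ (2≤∣e∣ G₂ (proj₁ (∈-∂ᵥ⁻ G₂ f∈∂))) =
      ∈-filter⁺ meets? f∈G
        ( (z , x∈p∩q⁺ (q⊆p∪q (f - ṽ) (s f) z∈ , s⊆V₁ f∈∂ z∈))
        , (x , x∈p∩q⁺ (x∈f , x∈p∧x∉q⇒x∈p─q (E⊆V G f∈G x∈f) (V₂∌V₁ (link⊆V₂ f∈∂ x∈)))) )
      where
      f∈G = splitEdge⁺ (cross f∈∂)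
      x∈f = p⊆p∪q (s f) x∈

  private
    -- A left inverse of `reattach` on the edges at `ṽ`: intersecting with `V G₂` strips off `s f`,
    -- which lies in `V G₁`.
    detach : Subset N → Subset N
    detach e = (e ∩ V G₂) ∪ ⁅ ṽ ⁆

    detach-reattach : ∀ {f} → f ∈ₗ ∂ᵥ G₂ ṽ → detach (reattach f) ≡ f
    detach-reattach {f} f∈∂ with f∈ , ṽ∈f ← ∈-∂ᵥ⁻ G₂ f∈∂ = ⊆-antisym ⊆f f⊆
      where
      ⊆f : detach (reattach f) ⊆ f
      ⊆f x∈ with x∈p∪q⁻ (reattach f ∩ V G₂) ⁅ ṽ ⁆ x∈
      ... | inj₂ x∈ṽ = subst (_∈ f) (sym (x∈⁅y⁆⇒x≡y ṽ x∈ṽ)) ṽ∈f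
      ... | inj₁ x∈∩ with x∈r , x∈V₂ ← x∈p∩q⁻ (reattach f) (V G₂) x∈∩ with x∈p∪q⁻ (f - ṽ) (s f) x∈r
      ...   | inj₁ x∈f  = p─q⊆p f ⁅ ṽ ⁆ x∈f
      ...   | inj₂ x∈sf = contradiction (s⊆V₁ f∈∂ x∈sf) (V₂∌V₁ x∈V₂)
      f⊆ : f ⊆ detach (reattach f)
      f⊆ {x} x∈ with x ≟ ṽ
      ... | yes refl = q⊆p∪q (reattach f ∩ V G₂) ⁅ ṽ ⁆ (x∈⁅x⁆ ṽ)
      ... | no x≢ṽ   = p⊆p∪q ⁅ ṽ ⁆
        (x∈p∩q⁺ (p⊆p∪q (s f) (x∈p∧x≢y⇒x∈p-y x∈ x≢ṽ) , E⊆V G₂ f∈ x∈))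

  -- Since `detach` recovers `f`, different edges at `ṽ` stay different after reattaching, and
  -- deduplication merges none of them.
  length-boundary : length (∂ G (V G₁)) ≡ length (∂ᵥ G₂ ṽ)
  length-boundary = trans
    (unique-set⇒length≡ (Unique.filter⁺ (meetsBoth? (V G₁) (V G ─ V G₁)) (E-unique G))
      (Unique.map⁻ (subst Unique (sym map-detach-reattach) (∂ᵥ-unique G₂ ṽ))) ∈-boundary⇔)
    (List.length-map reattach (∂ᵥ G₂ ṽ))
    where
    map-detach-reattach : map detach (map reattach (∂ᵥ G₂ ṽ)) ≡ ∂ᵥ G₂ ṽ
    map-detach-reattach = trans (sym (List.map-∘ (∂ᵥ G₂ ṽ)))
      (List.map-id-local (All.tabulate detach-reattach))

  -- A vertex of `ẽ` and a link vertex of an edge at `ṽ` witness that both sides are nonempty.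
  splitting-boundary-separating : IsConnected G → ∃ (_∈ₗ ∂ᵥ G₂ ṽ) → SeparatingEdgeSet G (∂ G (V G₁))
  splitting-boundary-separating conn (f , f∈∂)
    with z , z∈ ← edge-nonempty G₁ ẽ∈E₁
       | x , x∈ ← another-element ṽ (2≤∣e∣ G₂ (proj₁ (∈-∂ᵥ⁻ G₂ f∈∂))) =
    boundary-separating G (V G₁) conn
      (p⊆p∪q _ (E⊆V G₁ ẽ∈E₁ z∈)) (E⊆V G₁ ẽ∈E₁ z∈)
      (E⊆V G (splitEdge⁺ (cross f∈∂)) (p⊆p∪q (s f) x∈)) (V₂∌V₁ (link⊆V₂ f∈∂ x∈))

theorem15 : ∀ {N} (k : ℕ) → 2 ≤ k →
    (G₁ G₂ : Hypergraph N) (disjoint : Disjoint G₁ G₂) →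
    SucCritical k G₁ → SucCritical k G₂ →
    (ẽ : Subset N) (ẽ∈E₁ : ẽ ∈ₗ E G₁) →
    (ṽ : Fin N) → LowVertex k G₂ ṽ →
    (s : Subset N → Subset N) (adm : Admissible ẽ G₂ ṽ s) →
    let G = Splitting.S G₁ ẽ G₂ ṽ s disjoint ẽ∈E₁ adm in
    SucCritical k G ×
    SeparatingEdgeSet G (∂ G (V G₁)) ×
    length (∂ G (V G₁)) ≡ k
theorem15 (suc zero) (s≤s ())
-- The form `2 + m` of `k` supplies the two indices on which the choice of representatives and the
-- permutation argument rest.
theorem15 (suc (suc m)) _ G₁ G₂ disjoint crit₁ crit₂ ẽ ẽ∈E₁ ṽ (ṽ∈V₂ , degree≡k) s adm =
  crit ,
  splitting-boundary-separating G₁ G₂ disjoint ẽ∈E₁ ṽ s adm (critical⇒connected G crit) (f , f∈∂) ,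
  trans (length-boundary G₁ G₂ disjoint ẽ∈E₁ ṽ s adm) deg
  where
  G = Splitting.S G₁ ẽ G₂ ṽ s disjoint ẽ∈E₁ adm
  deg : length (∂ᵥ G₂ ṽ) ≡ 2 + m
  deg = trans (length-∂ᵥ G₂ ṽ) degree≡k
  crit = splitting-critical G₁ G₂ disjoint ẽ∈E₁ ṽ s adm crit₁ crit₂ ṽ∈V₂ deg
  f = proj₁ (no-isolated-vertex G₂ crit₂ ṽ∈V₂)
  f∈∂ = let f∈ , ṽ∈f = proj₂ (no-isolated-vertex G₂ crit₂ ṽ∈V₂) in v∈e⇒e∈∂ᵥ G₂ f∈ ṽ∈f
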